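{- Let $H$ be a finite hypergraph (multiple edges allowed) without edges of size $0$ or $1$. Then there are weightings $\rho: E(H)\to \{1,2,3\}$ and $\rho': V(H)\to \{1,2\}$ such that the induced total vertex weights $w(v):=\rho'(v)+\sum_{e\in E(H),\, e\ni v}\rho(e)$, $v\in V(H)$, properly color $V(H)$.
   Context: A hypergraph $H$ consists of a vertex set $V(H)$ and a collection $E(H)$ of subsets of $V(H)$, called edges; multiple edges are allowed, i.e. $E(H)$ may contain the same subset several times (each copy is a separate edge with its own weight, and sums over edges count copies separately). Edges need not have the same size. A function on $V(H)$ properly colors $V(H)$ if no edge is monochromatic, i.e. every edge contains at least two vertices with different values. -}

module Defs where

open import Data.Bool.Base using (if_then_else_)
open import Data.Fin.Base using (Fin)
open import Data.Fin.Subset using (Subset; _∈_)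
open import Data.Fin.Subset.Properties using (_∈?_)
open import Data.Nat.Base using (ℕ; _+_; _≤_)
open import Data.Nat.Properties using (+-0-commutativeMonoid)
open import Data.Product.Base using (∃₂; _×_)
open import Relation.Binary.PropositionalEquality.Core using (_≢_)
open import Relation.Nullary.Decidable.Core using (does)

open import Algebra.Properties.CommutativeMonoid.Sum +-0-commutativeMonoid
  using (sum; sum-syntax)

-- The edges are indexed, and `edge` need not be injective: this is what
-- allows multiple edges.
record Hypergraph : Set where
  field
    order : ℕ
    size  : ℕ

  Vertex : Set
  Vertex = Fin order

  Edge : Set
  Edge = Fin size

  field
    edge : Edge → Subset order

open Hypergraph public

-- The values of ρ lie in {1, …, k}.
IsWeighting : {A : Set} → ℕ → (A → ℕ) → Set
IsWeighting k ρ = ∀ x → 1 ≤ ρ x × ρ x ≤ k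

totalWeight : (H : Hypergraph) → (Edge H → ℕ) → (Vertex H → ℕ) → Vertex H → ℕ
totalWeight H ρ ρ′ v =
  ρ′ v + ∑[ e < size H ] (if does (v ∈? edge H e) then ρ e else 0)

ProperlyColors : (H : Hypergraph) → (Vertex H → ℕ) → Set
ProperlyColors H c =
  ∀ e → ∃₂ λ u v → u ∈ edge H e × v ∈ edge H e × c u ≢ c v

{-# OPTIONS --safe #-}

-- Kalkowski's algorithm, applied to the multigraph joining the two smallest
-- vertices first e < second e of every edge e.  The vertices are treated in
-- increasing order, and the weight of e, initially 2, is changed only when
-- second e is treated.  At v = second e, trading weight between e and the vertex
-- first e preserves the total weight of every vertex before v, because first e is
-- the only such vertex on e.  With one edge for each of the d vertices first e
-- this gives d + 1 consecutive possible totals at v, one of which differs from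
-- the d totals to be avoided.  Later vertices of e are affected too, but their
-- totals are not yet fixed.
module Submission where

open import Defs
open import Data.Fin.Base using (Fin; zero; suc; toℕ; fromℕ<; punchIn; _<_)
open import Data.Fin.Properties using (_≟_; punchInᵢ≢i; toℕ-fromℕ<; toℕ-injective; toℕ<n; <⇒≢)
open import Data.Fin.Subset using (Subset; ∣_∣; _∈_; _∉_; inside; outside)
open import Data.Fin.Subset.Properties using (_∈?_)
open import Data.List.Base using (List; []; _∷_; length; map; filter; deduplicate; allFin)
open import Data.List.Membership.Propositional using (lose) renaming (_∈_ to _∈ˡ_; _∉_ to _∉ˡ_)
open import Data.List.Membership.Propositional.Properties using (∈-filter⁺; ∈-allFin)
open import Data.List.Properties using (filter-notAll; length-map)
open import Data.List.Relation.Unary.All as All using (All; []; _∷_)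
open import Data.List.Relation.Unary.All.Properties as All using (all-filter)
open import Data.List.Relation.Unary.AllPairs using (AllPairs; []; _∷_)
open import Data.List.Relation.Unary.Any as Any using (Any; here; there)
open import Data.List.Relation.Unary.Any.Properties as Any using ()
open import Data.List.Relation.Unary.Unique.DecSetoid.Properties using (deduplicate-!)
open import Data.Bool.Base using (if_then_else_)
open import Data.Nat.Base as ℕ using (ℕ; zero; suc; _+_; _≤_; z≤n; s≤s)
open import Data.Nat.Properties as ℕ using (+-0-commutativeMonoid)
open import Data.Nat.Tactic.RingSolver using (solve-∀)
open import Data.Product.Base using (Σ-syntax; ∃-syntax; ∃₂; _×_; _,_; proj₁; proj₂)
open import Data.Sum.Base using (_⊎_; inj₁; inj₂)
open import Data.Vec.Base using ([]; _∷_; here; there)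
open import Data.Vec.Functional using (Vector; updateAt)
open import Data.Vec.Functional.Properties using (updateAt-updates; updateAt-minimal)
open import Function.Base using (_∘_; _on_; const)
open import Relation.Binary.Bundles using (DecSetoid)
open import Relation.Binary.Construct.On as On using ()
open import Relation.Binary.PropositionalEquality
open import Relation.Nullary using (¬?; yes; no; contradiction)
open import Relation.Nullary.Decidable using (does; dec-true; dec-false)

open import Data.List.Membership.DecPropositional ℕ._≟_
  using () renaming (_∈?_ to _∈ˡ?_)
open import Algebra.Properties.CommutativeMonoid.Sum +-0-commutativeMonoid
  using (sum; sum-remove; sum-cong-≗; sum-syntax)

-- The two smallest vertices of an edge.

IsMin : ∀ {n} → Subset n → Fin n → Set
IsMin p a = a ∈ p × (∀ x → x ∈ p → toℕ a ≤ toℕ x)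

min-exists : ∀ {n} (p : Subset n) → ∣ p ∣ ≢ 0 → ∃[ a ] IsMin p a
min-exists [] ≢0 = contradiction refl ≢0
min-exists (inside  ∷ p) _  = zero , here , λ _ _ → z≤n
min-exists (outside ∷ p) ≢0 with min-exists p ≢0
... | a , a∈p , a≤ = suc a , there a∈p , λ where (suc x) (there x∈p) → s≤s (a≤ x x∈p)

-- `only-first` is the form in which a trade uses that a single vertex of the edge precedes
-- `second`; together with `first<second` it makes `first` the minimum.
record TwoSmallest {n} (p : Subset n) : Set where
  field
    first second : Fin n
    first∈       : first ∈ p
    second∈      : second ∈ p
    first<second : first < second
    only-first   : ∀ x → x ∈ p → x < second → x ≡ first

two-smallest : ∀ {n} (p : Subset n) → ∣ p ∣ ≢ 0 → ∣ p ∣ ≢ 1 → TwoSmallest p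
two-smallest [] ≢0 _ = contradiction refl ≢0
two-smallest (inside ∷ p) _ ≢1 with min-exists p (≢1 ∘ cong suc)
... | b , b∈p , b≤ = record
  { first        = zero
  ; second       = suc b
  ; first∈       = here
  ; second∈      = there b∈p
  ; first<second = s≤s z≤n
  ; only-first   = λ where
      zero    _           _         → refl
      (suc x) (there x∈p) (s≤s x<b) → contradiction (b≤ x x∈p) (ℕ.<⇒≱ x<b)
  }
two-smallest (outside ∷ p) ≢0 ≢1 = record
  { first        = suc T.first
  ; second       = suc T.second
  ; first∈       = there T.first∈
  ; second∈      = there T.second∈
  ; first<second = s≤s T.first<second
  ; only-first   = λ where
      (suc x) (there x∈p) (s≤s x<b) → cong suc (T.only-first x x∈p x<b)
  }
  where module T = TwoSmallest (two-smallest p ≢0 ≢1)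

-- Avoiding finitely many values.

-- If `x` occurs in `F`, filtering it out shortens `F` and the search goes on from `suc x`. All
-- later candidates exceed `x`, so the removal cannot hide a hit. The bound `n` is separate because
-- filtering may remove several copies at once.
avoid-bounded : ∀ n (F : List ℕ) x → length F ≤ n → ∃[ t ] t ≤ n × x + t ∉ˡ F
avoid-bounded n F x |F|≤n with x ∈ˡ? F
avoid-bounded n F x |F|≤n | no x∉F =
  0 , z≤n , subst (_∉ˡ F) (sym (ℕ.+-identityʳ x)) x∉F
avoid-bounded zero [] x _ | yes ()
avoid-bounded (suc n) F x |F|≤n | yes x∈F
  with avoid-bounded n (filter (λ y → ¬? (x ℕ.≟ y)) F) (suc x)
         (ℕ.≤-pred (ℕ.≤-trans
           (filter-notAll (λ y → ¬? (x ℕ.≟ y)) F (Any.map (λ x≡y x≢y → x≢y x≡y) x∈F))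
           |F|≤n))
... | t , t≤n , ∉F′ = suc t , s≤s t≤n , λ ∈F →
  ∉F′ (∈-filter⁺ (λ y → ¬? (x ℕ.≟ y)) (subst (_∈ˡ F) (ℕ.+-suc x t) ∈F) (ℕ.m≢1+m+n x))

avoid : ∀ (F : List ℕ) x → ∃[ t ] t ≤ length F × x + t ∉ˡ F
avoid F x = avoid-bounded (length F) F x ℕ.≤-refl

-- Changing one weight.

-- Adding to each sum the other one's term at `i` expresses the change without truncated
-- subtraction.
sum-agree-off : ∀ {n} {f g : Vector ℕ n} i → (∀ j → j ≢ i → f j ≡ g j) →
  sum f + g i ≡ sum g + f i
sum-agree-off {suc n} {f} {g} i agree = begin
  sum f + g i                     ≡⟨ cong (_+ g i) (sum-remove {i = i} f) ⟩
  f i + sum (f ∘ punchIn i) + g i ≡⟨ cong (λ s → f i + s + g i) (sum-cong-≗ λ j → agree _ (punchInᵢ≢i i j)) ⟩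
  f i + sum (g ∘ punchIn i) + g i ≡⟨ swap (f i) _ (g i) ⟩
  g i + sum (g ∘ punchIn i) + f i ≡⟨ cong (_+ f i) (sum-remove {i = i} g) ⟨
  sum g + f i                     ∎
  where
  open ≡-Reasoning
  swap : ∀ a s b → a + s + b ≡ b + s + a
  swap = solve-∀

_[_≔_] : ∀ {n} → Vector ℕ n → Fin n → ℕ → Vector ℕ n
f [ i ≔ x ] = updateAt f i (const x)

≔-updates : ∀ {n} (f : Vector ℕ n) i x → (f [ i ≔ x ]) i ≡ x
≔-updates f i x = updateAt-updates i f

≔-minimal : ∀ {n} (f : Vector ℕ n) {i j} x → j ≢ i → (f [ i ≔ x ]) j ≡ f j
≔-minimal f {i} {j} x j≢i = updateAt-minimal j i f j≢i

≔-isWeighting : ∀ {n k} {f : Vector ℕ n} i {x} → 1 ≤ x × x ≤ k →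
  IsWeighting k f → IsWeighting k (f [ i ≔ x ])
≔-isWeighting {k = k} {f} i {x} x-ok f-ok j with j ≟ i
... | yes refl = subst (λ y → 1 ≤ y × y ≤ k) (sym (≔-updates f i x)) x-ok
... | no  j≢i  = subst (λ y → 1 ≤ y × y ≤ k) (sym (≔-minimal f x j≢i)) (f-ok j)

-- The edge weight that keeps the sum of an edge of weight 2 and a vertex of
-- weight a when the vertex weight becomes p.
trade : ∀ {a p} → 1 ≤ a × a ≤ 2 → 1 ≤ p × p ≤ 2 → ∃[ q ] (1 ≤ q × q ≤ 3) × q + p ≡ 2 + a
trade {1} {1} _ _ = 2 , (s≤s z≤n , s≤s (s≤s z≤n)) , refl
trade {1} {2} _ _ = 1 , (s≤s z≤n , s≤s z≤n) , refl
trade {2} {1} _ _ = 3 , (s≤s z≤n , ℕ.≤-refl) , refl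
trade {2} {2} _ _ = 2 , (s≤s z≤n , s≤s (s≤s z≤n)) , refl
trade {suc (suc (suc _))} (_ , s≤s (s≤s ())) _
trade {_} {suc (suc (suc _))} _ (_ , s≤s (s≤s ()))

total-after-trade : ∀ {s s₁ a p q} → s₁ + 2 ≡ s + q → q + p ≡ 2 + a → s₁ + p ≡ s + a
total-after-trade {s} {s₁} {a} {p} {q} s-eq q-eq = ℕ.+-cancelʳ-≡ 2 _ _ (begin
  s₁ + p + 2   ≡⟨ swap s₁ p ⟩
  s₁ + 2 + p   ≡⟨ cong (_+ p) s-eq ⟩
  s + q + p    ≡⟨ ℕ.+-assoc s q p ⟩
  s + (q + p)  ≡⟨ cong (s +_) q-eq ⟩
  s + (2 + a)  ≡⟨ swap′ s a ⟩
  s + a + 2    ∎)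
  where
  open ≡-Reasoning
  swap : ∀ x y → x + y + 2 ≡ x + 2 + y
  swap = solve-∀
  swap′ : ∀ x y → x + (2 + y) ≡ x + y + 2
  swap′ = solve-∀

module _ (H : Hypergraph) where

  edgeSum : (Edge H → ℕ) → Vertex H → ℕ
  edgeSum ρ v = ∑[ e < size H ] (if does (v ∈? edge H e) then ρ e else 0)

  edgeSum-update : ∀ ρ e q v →
    edgeSum (ρ [ e ≔ q ]) v + (if does (v ∈? edge H e) then ρ e else 0) ≡
    edgeSum ρ v + (if does (v ∈? edge H e) then q else 0)
  edgeSum-update ρ e q v = trans
    (sum-agree-off e λ j j≢e → cong (if does (v ∈? edge H j) then_else 0) (≔-minimal ρ q j≢e))
    (cong (λ y → edgeSum ρ v + (if does (v ∈? edge H e) then y else 0)) (≔-updates ρ e q))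

  edgeSum-update-∈ : ∀ ρ e q {v} → v ∈ edge H e →
    edgeSum (ρ [ e ≔ q ]) v + ρ e ≡ edgeSum ρ v + q
  edgeSum-update-∈ ρ e q {v} v∈e
    with eq ← edgeSum-update ρ e q v rewrite dec-true (v ∈? edge H e) v∈e = eq

  edgeSum-update-∉ : ∀ ρ e q {v} → v ∉ edge H e →
    edgeSum (ρ [ e ≔ q ]) v ≡ edgeSum ρ v
  edgeSum-update-∉ ρ e q {v} v∉e
    with eq ← edgeSum-update ρ e q v rewrite dec-false (v ∈? edge H e) v∉e =
    ℕ.+-cancelʳ-≡ 0 _ _ eq

-- Trading along a single edge.

module Kalkowski (H : Hypergraph) (smallest : ∀ e → TwoSmallest (edge H e)) where

  module _ (e : Edge H) where
    open TwoSmallest (smallest e) public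

  private
    w = totalWeight H

  module _ {ρ : Edge H → ℕ} {ρ′ : Vertex H → ℕ} (e : Edge H) (ρe≡2 : ρ e ≡ 2)
           {p q : ℕ} (q-eq : q + p ≡ 2 + ρ′ (first e)) where

    private
      ρ₁  = ρ [ e ≔ q ]
      ρ₁′ = ρ′ [ first e ≔ p ]

      -- At `first e` this says that the total is kept; at `second e`, whose own vertex weight does
      -- not change, that the total moves by `ρ′ (first e) - p`.
      edgeSum-trade : ∀ {v} → v ∈ edge H e →
        edgeSum H ρ₁ v + p ≡ edgeSum H ρ v + ρ′ (first e)
      edgeSum-trade {v} v∈e = total-after-trade
        (trans (cong (edgeSum H ρ₁ v +_) (sym ρe≡2)) (edgeSum-update-∈ H ρ e q v∈e)) q-eq

    trade-below : ∀ x → x < second e → w ρ₁ ρ₁′ x ≡ w ρ ρ′ x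
    trade-below x x<second with x ∈? edge H e
    ... | no x∉e = cong₂ _+_
      (≔-minimal ρ′ p λ { refl → x∉e (first∈ e) }) (edgeSum-update-∉ H ρ e q x∉e)
    ... | yes x∈e with refl ← only-first e x x∈e x<second = begin
      ρ₁′ x + edgeSum H ρ₁ x ≡⟨ cong (_+ edgeSum H ρ₁ x) (≔-updates ρ′ x p) ⟩
      p + edgeSum H ρ₁ x     ≡⟨ ℕ.+-comm p _ ⟩
      edgeSum H ρ₁ x + p     ≡⟨ edgeSum-trade x∈e ⟩
      edgeSum H ρ x + ρ′ x   ≡⟨ ℕ.+-comm _ (ρ′ x) ⟩
      ρ′ x + edgeSum H ρ x   ∎
      where open ≡-Reasoning

    trade-second : w ρ₁ ρ₁′ (second e) + p ≡ w ρ ρ′ (second e) + ρ′ (first e)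
    trade-second = begin
      ρ₁′ v + edgeSum H ρ₁ v + p              ≡⟨ cong (λ y → y + edgeSum H ρ₁ v + p) ρ₁′v≡ρ′v ⟩
      ρ′ v + edgeSum H ρ₁ v + p               ≡⟨ ℕ.+-assoc (ρ′ v) _ p ⟩
      ρ′ v + (edgeSum H ρ₁ v + p)             ≡⟨ cong (ρ′ v +_) (edgeSum-trade (second∈ e)) ⟩
      ρ′ v + (edgeSum H ρ v + ρ′ (first e))   ≡⟨ ℕ.+-assoc (ρ′ v) _ _ ⟨
      ρ′ v + edgeSum H ρ v + ρ′ (first e)     ∎
      where
      open ≡-Reasoning
      v = second e
      ρ₁′v≡ρ′v : ρ₁′ v ≡ ρ′ v
      ρ₁′v≡ρ′v = ≔-minimal ρ′ p (≢-sym (<⇒≢ (first<second e)))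

  -- Consecutive totals at one vertex.

  -- By `total`, the new total at `v` is `b - c + t`; since `b` and `c` will be shared by all `t`,
  -- consecutive offsets `t` mean consecutive totals. `same-edges` and `same-vertices` allow the
  -- trades for different edges to be made one after another.
  record Reweighting (v : Vertex H) (L : List (Edge H))
                     (ρ : Edge H → ℕ) (ρ′ : Vertex H → ℕ) (b c t : ℕ) : Set where
    field
      ρ₁             : Edge H → ℕ
      ρ₁′            : Vertex H → ℕ
      ρ₁-weighting   : IsWeighting 3 ρ₁
      ρ₁′-weighting  : IsWeighting 2 ρ₁′
      same-edges     : ∀ e → e ∉ˡ L → ρ₁ e ≡ ρ e
      same-vertices  : ∀ u → All (λ e → u ≢ first e) L → ρ₁′ u ≡ ρ′ u
      below          : ∀ x → x < v → w ρ₁ ρ₁′ x ≡ w ρ ρ′ x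
      total          : w ρ₁ ρ₁′ v + c ≡ b + t

  module _ {v : Vertex H} {ρ : Edge H → ℕ} {ρ′ : Vertex H → ℕ}
           (ρ-weighting : IsWeighting 3 ρ) (ρ′-weighting : IsWeighting 2 ρ′)
           (ρ≡2 : ∀ e → second e ≡ v → ρ e ≡ 2) where

    -- The trade moves the total at `v` by `ρ′ (first e) - p`. This splits into `ρ′ (first e) - 2`,
    -- which is independent of `p` and goes into `b` and `c`, and `2 - p`, the step from `t` to
    -- `t₁`.
    extend : ∀ {e L b c t} p t₁ → second e ≡ v → All (λ f → first e ≢ first f) L →
      1 ≤ p × p ≤ 2 → p + t₁ ≡ 2 + t →
      Reweighting v L ρ ρ′ b c t →
      Reweighting v (e ∷ L) ρ ρ′ (b + ρ′ (first e)) (c + 2) t₁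
    extend {e} {L} {b} {c} {t} p t₁ refl new p-ok p-eq R
      with trade {ρ′ (first e)} {p} (ρ′-weighting (first e)) p-ok
    ... | q , q-ok , q-eq = record
      { ρ₁            = ρ₁ [ e ≔ q ]
      ; ρ₁′           = ρ₁′ [ first e ≔ p ]
      ; ρ₁-weighting  = ≔-isWeighting e q-ok ρ₁-weighting
      ; ρ₁′-weighting = ≔-isWeighting (first e) p-ok ρ₁′-weighting
      ; same-edges    = λ f f∉ →
          trans (≔-minimal ρ₁ q (f∉ ∘ here)) (same-edges f (f∉ ∘ there))
      ; same-vertices = λ { u (u≢ ∷ u∉) →
          trans (≔-minimal ρ₁′ p u≢) (same-vertices u u∉) }
      ; below         = λ x x<v → trans (trade-below e ρ₁e≡2 q-eq₁ x x<v) (below x x<v)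
      ; total         = ℕ.+-cancelʳ-≡ p _ _ (begin
          w₁ + (c + 2) + p      ≡⟨ solve w₁ c p ⟩
          w₁ + p + c + 2        ≡⟨ cong (λ y → y + c + 2) (trade-second e ρ₁e≡2 q-eq₁) ⟩
          w₀ + ρ₁′ u + c + 2    ≡⟨ cong (λ y → w₀ + y + c + 2) ρ₁′u≡ ⟩
          w₀ + ρ′ u + c + 2     ≡⟨ solve₁ w₀ (ρ′ u) c ⟩
          w₀ + c + ρ′ u + 2     ≡⟨ cong (λ y → y + ρ′ u + 2) total ⟩
          b + t + ρ′ u + 2      ≡⟨ solve₂ b t (ρ′ u) ⟩
          b + ρ′ u + (2 + t)    ≡⟨ cong (b + ρ′ u +_) p-eq ⟨
          b + ρ′ u + (p + t₁)   ≡⟨ solve₃ (b + ρ′ u) p t₁ ⟩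
          b + ρ′ u + t₁ + p     ∎)
      }
      where
      open Reweighting R
      open ≡-Reasoning
      u = first e
      ρ₁e≡2 : ρ₁ e ≡ 2
      -- If `e` were in `L`, `new` would make its first vertex differ from itself; so `e` still has
      -- weight 2.
      ρ₁e≡2 = trans (same-edges e λ e∈L → All.lookup new e∈L refl) (ρ≡2 e refl)
      ρ₁′u≡ : ρ₁′ u ≡ ρ′ u
      ρ₁′u≡ = same-vertices u new
      q-eq₁ : q + p ≡ 2 + ρ₁′ u
      q-eq₁ = trans q-eq (cong (2 +_) (sym ρ₁′u≡))
      w₀ = w ρ₁ ρ₁′ v
      w₁ = w (ρ₁ [ e ≔ q ]) (ρ₁′ [ u ≔ p ]) v
      solve : ∀ a c p → a + (c + 2) + p ≡ a + p + c + 2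
      solve = solve-∀
      solve₁ : ∀ a r c → a + r + c + 2 ≡ a + c + r + 2
      solve₁ = solve-∀
      solve₂ : ∀ b t r → b + t + r + 2 ≡ b + r + (2 + t)
      solve₂ = solve-∀
      solve₃ : ∀ b p t → b + (p + t) ≡ b + t + p
      solve₃ = solve-∀

    attainable : ∀ L → All (λ e → second e ≡ v) L → AllPairs (_≢_ on first) L →
      ∃₂ λ b c → ∀ t → t ≤ length L → Reweighting v L ρ ρ′ b c t
    attainable [] _ _ = w ρ ρ′ v , 0 , λ where
      zero _ → record
        { ρ₁            = ρ
        ; ρ₁′           = ρ′
        ; ρ₁-weighting  = ρ-weighting
        ; ρ₁′-weighting = ρ′-weighting
        ; same-edges    = λ _ _ → refl
        ; same-vertices = λ _ _ → refl
        ; below         = λ _ _ → refl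
        ; total         = refl
        }
    attainable (e ∷ L) (at-v ∷ all-at-v) (new ∷ distinct)
      with attainable L all-at-v distinct
    ... | b , c , R = b + ρ′ (first e) , c + 2 , λ where
      -- Vertex weight 2 keeps the offset and vertex weight 1 raises it by one, whatever the old
      -- weight was. So each edge adds one attainable offset.
      zero    _         → extend 2 0 at-v new (s≤s z≤n , ℕ.≤-refl) refl (R 0 z≤n)
      (suc t) (s≤s t≤)  → extend 1 (suc t) at-v new (ℕ.≤-refl , s≤s z≤n) refl (R t t≤)

  -- Edges that share both `first` and `second` demand the same inequality, so one of them suffices.
  -- Distinct first vertices ensure that no vertex weight is traded twice.
  representatives : ∀ v → ∃[ L ] All (λ e → second e ≡ v) L × AllPairs (_≢_ on first) L ×
    (∀ e → second e ≡ v → Any (λ f → first f ≡ first e) L)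
  representatives v =
      deduplicate _≟₁_ candidates
    , All.deduplicate⁺ _≟₁_ (all-filter (λ e → second e ≟ v) (allFin _))
    , deduplicate-! byFirst candidates
    , λ e at-v → Any.deduplicate⁺ _≟₁_ (λ x≡y → trans x≡y)
        (lose (∈-filter⁺ (λ f → second f ≟ v) (∈-allFin e) at-v) refl)
    where
    byFirst = On.decSetoid (decSetoid (_≟_ {order H})) first
    open DecSetoid byFirst using () renaming (_≟_ to _≟₁_)
    candidates = filter (λ e → second e ≟ v) (allFin (size H))

  -- Treating the vertices in increasing order.

  -- The vertices below `k` have been treated. `untouched` keeps the remaining edges available for
  -- trading: weight 2 can move by one either way within 1, 2, 3.
  record Stage (k : ℕ) : Set where
    field
      ρ            : Edge H → ℕ
      ρ′           : Vertex H → ℕ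
      ρ-weighting  : IsWeighting 3 ρ
      ρ′-weighting : IsWeighting 2 ρ′
      untouched    : ∀ e → k ≤ toℕ (second e) → ρ e ≡ 2
      separated    : ∀ e → toℕ (second e) ℕ.< k → w ρ ρ′ (first e) ≢ w ρ ρ′ (second e)

  initial : Stage 0
  initial = record
    { ρ            = const 2
    ; ρ′           = const 1
    ; ρ-weighting  = λ _ → s≤s z≤n , s≤s (s≤s z≤n)
    ; ρ′-weighting = λ _ → s≤s z≤n , s≤s z≤n
    ; untouched    = λ _ _ → refl
    ; separated    = λ _ ()
    }

  advance : ∀ v → Stage (toℕ v) → Stage (suc (toℕ v))
  advance v S with representatives v
  ... | L , at-v , distinct , covers
    with attainable (Stage.ρ-weighting S) (Stage.ρ′-weighting S)
           (λ e eq → Stage.untouched S e (ℕ.≤-reflexive (cong toℕ (sym eq)))) L at-v distinct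
  ... | b , c , R
    -- `b + t` is the new total at `v` plus `c`, so the forbidden totals are shifted by `c` as well.
    -- The old totals can be listed because the trades at `v` preserve all totals below `v`. There
    -- is one more offset than there are entries in the list.
    with avoid (map (λ e → w (Stage.ρ S) (Stage.ρ′ S) (first e) + c) L) b
  ... | t , t≤ , b+t∉ = record
    { ρ            = ρ₁
    ; ρ′           = ρ₁′
    ; ρ-weighting  = ρ₁-weighting
    ; ρ′-weighting = ρ₁′-weighting
    ; untouched    = λ e v<second → trans
        (same-edges e λ e∈L → ℕ.<⇒≢ v<second (cong toℕ (sym (All.lookup at-v e∈L))))
        (untouched e (ℕ.<⇒≤ v<second))
    ; separated    = λ e second≤v → separated₁ e (ℕ.m≤n⇒m<n∨m≡n (ℕ.≤-pred second≤v))
    }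
    where
    open Stage S
    open Reweighting (R t (subst (t ≤_) (length-map _ L) t≤))
    separated₁ : ∀ e → toℕ (second e) ℕ.< toℕ v ⊎ toℕ (second e) ≡ toℕ v →
      w ρ₁ ρ₁′ (first e) ≢ w ρ₁ ρ₁′ (second e)
    separated₁ e (inj₁ second<v) eq = separated e second<v (begin
      w ρ ρ′ (first e)     ≡⟨ below (first e) (ℕ.<-trans (first<second e) second<v) ⟨
      w ρ₁ ρ₁′ (first e)   ≡⟨ eq ⟩
      w ρ₁ ρ₁′ (second e)  ≡⟨ below (second e) second<v ⟩
      w ρ ρ′ (second e)    ∎)
      where open ≡-Reasoning
    -- `e` itself need not be in `L`, but `covers` gives an `f` in `L` with the same first vertex,
    -- so equal totals would put `b + t` on the forbidden list.
    separated₁ e (inj₂ second≡v) eq with refl ← toℕ-injective second≡v =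
      b+t∉ (Any.map⁺ (Any.map (λ {f} first≡ → begin
        b + t                       ≡⟨ total ⟨
        w ρ₁ ρ₁′ (second e) + c     ≡⟨ cong (_+ c) eq ⟨
        w ρ₁ ρ₁′ (first e) + c      ≡⟨ cong (_+ c) (below (first e) (first<second e)) ⟩
        w ρ ρ′ (first e) + c        ≡⟨ cong (λ u → w ρ ρ′ u + c) first≡ ⟨
        w ρ ρ′ (first f) + c        ∎) (covers e refl)))
      where open ≡-Reasoning

  stage : ∀ k → k ≤ order H → Stage k
  stage zero    _   = initial
  stage (suc k) k<n = subst (Stage ∘ suc) (toℕ-fromℕ< k<n)
    (advance (fromℕ< k<n) (subst Stage (sym (toℕ-fromℕ< k<n)) (stage k (ℕ.<⇒≤ k<n))))

theorem9 : (H : Hypergraph) →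
    (∀ e → ∣ edge H e ∣ ≢ 0 × ∣ edge H e ∣ ≢ 1) →
    Σ[ ρ ∈ (Edge H → ℕ) ] Σ[ ρ′ ∈ (Vertex H → ℕ) ]
    (IsWeighting 3 ρ × IsWeighting 2 ρ′ × ProperlyColors H (totalWeight H ρ ρ′))
theorem9 H large = ρ , ρ′ , ρ-weighting , ρ′-weighting ,
  -- At stage `order H` the second vertex of every edge has been treated.
  λ e → first e , second e , first∈ e , second∈ e , separated e (toℕ<n (second e))
  where
  open Kalkowski H (λ e → two-smallest (edge H e) (proj₁ (large e)) (proj₂ (large e)))
  open Stage (stage (order H) ℕ.≤-refl)
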